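{- Let $k,\ell,n\ge 1$ be integers. If each vertex of the graph $K_{\ell}\times P_n$ is colored uniformly and independently with one of $k$ colors, the expected number of blocks (the expected size of the resulting $k$-colored partition) is $$\mathbb{E}[X_k(K_{\ell}\times P_n)]=\frac{k^{\ell n-(2\ell -1)}\left(\left(k^{2\ell}-(k^2-1)^{\ell}\right)+(k-1)^{\ell}\left((k+1)^{\ell}-k^{\ell}\right)n\right)}{k^{\ell n}}.$$
   Context: $K_\ell$ is the complete graph on $\ell$ vertices and $P_n$ the path graph on $n$ vertices. The product $G_1\times G_2$ of graphs $G_1=(V_1,E_1)$, $G_2=(V_2,E_2)$ is the Cartesian product: its vertex set is $V_1\times V_2$, and $(v_1,v_2),(w_1,w_2)$ are adjacent iff ($v_1=w_1$ and $\{v_2,w_2\}\in E_2$) or ($v_2=w_2$ and $\{v_1,w_1\}\in E_1$). Given a coloring of the vertices of a finite graph $G$ with $k$ colors, the blocks are the connected components of the subgraph of $G$ formed by all vertices and all edges whose two endpoints have the same color. $X_k(G)$ denotes the number of blocks when each vertex of $G$ receives independently a uniformly random color among $k$ colors. -}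

module Defs where

open import Algebra.Bundles using (CommutativeRing)
open import Data.Fin.Base using (Fin; zero; suc; toℕ; finToFun; punchIn; punchOut)
open import Data.Fin.Properties using (_≟_; *↔×; punchInᵢ≢i; punchOut-cong; punchOut-injective; punchOut-punchIn)
open import Data.Integer.Base using (ℤ; +_; -[1+_])
open import Data.List.Base using (List; []; _∷_; map; allFin; cartesianProduct)
open import Data.List.Membership.Propositional using (_∈_)
open import Data.List.Membership.Propositional.Properties using (∈-map⁺; ∈-allFin; ∈-cartesianProduct⁺)
open import Data.List.Relation.Unary.Any using (here; there)
open import Data.Nat.Base as ℕ using (ℕ; zero; suc)
import Data.Nat.Properties as ℕ
open import Data.Product.Base using (Σ; ∃; _×_; _,_; proj₁; proj₂)
open import Data.Product.Function.NonDependent.Propositional using (_×-↔_)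
open import Data.Rational.Base as ℚ using (ℚ; _/_; 1/_; Positive)
import Data.Rational.Properties as ℚ
open import Data.Sum.Base using (_⊎_; inj₁; inj₂)
open import Function.Base using (_∘_)
open import Function.Bundles using (_↔_; Inverse; Injection; _⇔_; mk⇔)
open import Function.Construct.Identity using (↔-id)
open import Function.Construct.Composition using (_↔-∘_)
open import Function.Construct.Symmetry using (↔-sym)
open import Function.Properties.Inverse using (↔⇒↣)
open import Function.Definitions using (Surjective)
open import Relation.Binary.Construct.Closure.ReflexiveTransitive using (Star; ε; _◅_; _◅◅_; reverse)
open import Relation.Binary.PropositionalEquality
open import Relation.Nullary using (¬_; Dec; yes; no; contradiction)
open import Relation.Nullary.Decidable using (¬?; _×-dec_; _⊎-dec_)

record FiniteGraph : Set₁ where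
  field
    V       : Set
    _~_     : V → V → Set
    ~-sym   : ∀ {v w} → v ~ w → w ~ v
    ~-irrefl : ∀ {v} → ¬ (v ~ v)
    _~?_    : ∀ v w → Dec (v ~ w)
    order   : ℕ
    enum    : V ↔ Fin order

  index : V → Fin order
  index = Inverse.to enum

  vertex : Fin order → V
  vertex = Inverse.from enum

  index-injective : ∀ {v w} → index v ≡ index w → v ≡ w
  index-injective = Injection.injective (↔⇒↣ enum)

open FiniteGraph using (V; order)

K : ℕ → FiniteGraph
K ℓ = record
  { V        = Fin ℓ
  ; _~_      = _≢_
  ; ~-sym    = ≢-sym
  ; ~-irrefl = λ v≢v → v≢v refl
  ; _~?_     = λ v w → ¬? (v ≟ w)
  ; order    = ℓ
  ; enum     = ↔-id (Fin ℓ)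
  }

P : ℕ → FiniteGraph
P n = record
  { V        = Fin n
  ; _~_      = λ v w → toℕ w ≡ suc (toℕ v) ⊎ toℕ v ≡ suc (toℕ w)
  ; ~-sym    = λ { (inj₁ p) → inj₂ p ; (inj₂ p) → inj₁ p }
  ; ~-irrefl = λ { (inj₁ p) → ℕ.1+n≢n (sym p) ; (inj₂ p) → ℕ.1+n≢n (sym p) }
  ; _~?_     = λ v w → (toℕ w ℕ.≟ suc (toℕ v)) ⊎-dec (toℕ v ℕ.≟ suc (toℕ w))
  ; order    = n
  ; enum     = ↔-id (Fin n)
  }

infixr 7 _□_

_□_ : FiniteGraph → FiniteGraph → FiniteGraph
G □ H = record
  { V        = G.V × H.V
  ; _~_      = λ (v₁ , v₂) (w₁ , w₂) → (v₁ ≡ w₁ × v₂ H.~ w₂) ⊎ (v₂ ≡ w₂ × v₁ G.~ w₁)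
  ; ~-sym    = λ { (inj₁ (p , e)) → inj₁ (sym p , H.~-sym e)
                 ; (inj₂ (p , e)) → inj₂ (sym p , G.~-sym e) }
  ; ~-irrefl = λ { (inj₁ (_ , e)) → H.~-irrefl e ; (inj₂ (_ , e)) → G.~-irrefl e }
  ; _~?_     = λ (v₁ , v₂) (w₁ , w₂) →
                 (≟V G v₁ w₁ ×-dec (v₂ H.~? w₂)) ⊎-dec (≟V H v₂ w₂ ×-dec (v₁ G.~? w₁))
  ; order    = G.order ℕ.* H.order
  ; enum     = ↔-sym *↔× ↔-∘ (G.enum ×-↔ H.enum)
  }
  where
  module G = FiniteGraph G
  module H = FiniteGraph H

  ≟V : (G : FiniteGraph) (v w : V G) → Dec (v ≡ w)
  ≟V G v w with FiniteGraph.index G v ≟ FiniteGraph.index G w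
  ... | yes p = yes (FiniteGraph.index-injective G p)
  ... | no ¬p = no (¬p ∘ cong (FiniteGraph.index G))

module _ (G : FiniteGraph) where
  open FiniteGraph G hiding (V; order)

  Connected : V G → V G → Set
  Connected = Star _~_

  -- A numbering of the connected components by Fin number: each vertex is
  -- labelled by its component, and every label is used.
  record Components : Set where
    field
      number     : ℕ
      component  : V G → Fin number
      surjective : Surjective _≡_ _≡_ component
      connected  : ∀ v w → component v ≡ component w ⇔ Connected v w

  private
    -- A quotient of the vertex set that is at least as fine as connectedness.
    record Partial : Set where
      field
        size  : ℕ
        label : V G → Fin size
        surj  : ∀ i → ∃ λ v → label v ≡ i
        sound : ∀ v w → label v ≡ label w → Connected v w

    open Partial

    _⊑_ : Partial → Partial → Set
    S ⊑ T = ∀ v w → label S v ≡ label S w → label T v ≡ label T w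

    discrete : Partial
    discrete = record
      { size  = order G
      ; label = index
      ; surj  = λ i → vertex i , Inverse.strictlyInverseˡ enum i
      ; sound = λ v w p → subst (Connected v) (index-injective p) ε
      }

    merge : ∀ S {v w} → v ~ w → Σ Partial λ T → S ⊑ T × label T v ≡ label T w
    merge S {v} {w} v~w with label S v ≟ label S w
    merge S v~w | yes p = S , (λ _ _ q → q) , p
    merge record { size = zero ; label = f } {v} v~w | no _ = contradiction (f v) λ ()
    merge record { size = suc m ; label = f ; surj = sj ; sound = sd } {v} {w} v~w | no fv≢fw =
      record { size = m ; label = g ; surj = surj′ ; sound = sound′ } , coarser , gv≡gw
      where
      -- Send the class of v to that of w and delete the label of v.
      h : (i : Fin (suc m)) → Dec (f v ≡ i) → Fin m
      h i (yes _) = punchOut fv≢fw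
      h i (no ¬p) = punchOut ¬p

      g : V G → Fin m
      g x = h (f x) (f v ≟ f x)

      coarser : ∀ x y → f x ≡ f y → g x ≡ g y
      coarser x y p = cong (λ i → h i (f v ≟ i)) p

      gv≡gw : g v ≡ g w
      gv≡gw with f v ≟ f v | f v ≟ f w
      ... | yes _ | yes p = contradiction p fv≢fw
      ... | yes _ | no _  = punchOut-cong (f v) refl
      ... | no ¬p | _     = contradiction refl ¬p

      surj′ : ∀ i → ∃ λ x → g x ≡ i
      surj′ i with sj (punchIn (f v) i)
      ... | x , p = x , lemma
        where
        lemma : g x ≡ i
        lemma with f v ≟ f x
        ... | yes q = contradiction (sym (trans q p)) (punchInᵢ≢i (f v) i)
        ... | no ¬q = trans (punchOut-cong (f v) p) (punchOut-punchIn (f v))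

      v→w : Connected v w
      v→w = v~w ◅ ε

      sound′ : ∀ x y → g x ≡ g y → Connected x y
      sound′ x y p with f v ≟ f x | f v ≟ f y
      ... | yes q | yes r = sd x y (trans (sym q) r)
      ... | yes q | no r  = sd x v (sym q) ◅◅ v→w ◅◅ sd w y (punchOut-injective fv≢fw r p)
      ... | no q  | yes r = sd x w (punchOut-injective q fv≢fw p) ◅◅ reverse ~-sym v→w ◅◅ sd v y r
      ... | no q  | no r  = sd x y (punchOut-injective q r p)

    mergeAll : (es : List (V G × V G)) → ∀ S → Σ Partial λ T → S ⊑ T ×
               (∀ {v w} → (v , w) ∈ es → v ~ w → label T v ≡ label T w)
    mergeAll [] S = S , (λ _ _ p → p) , λ ()
    mergeAll ((v , w) ∷ es) S with v ~? w
    ... | no ¬e = let T , S⊑T , all = mergeAll es S in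
      T , S⊑T , λ { (here refl) e → contradiction e ¬e ; (there i) → all i }
    ... | yes e = let T , S⊑T , p = merge S e
                      U , T⊑U , all = mergeAll es T in
      U , (λ x y q → T⊑U x y (S⊑T x y q)) ,
      λ { (here refl) _ → T⊑U _ _ p ; (there i) → all i }

    vertices : List (V G)
    vertices = map vertex (allFin (order G))

    ∈-vertices : ∀ v → v ∈ vertices
    ∈-vertices v = subst (_∈ vertices) (Inverse.strictlyInverseʳ enum v) (∈-map⁺ vertex (∈-allFin (index v)))

  components : Components
  components = record
    { number     = size T
    ; component  = label T
    ; surjective = λ i → let v , p = surj T i in v , λ { refl → p }
    ; connected  = λ v w → mk⇔ (sound T v w) complete
    }
    where
    result = mergeAll (cartesianProduct vertices vertices) discrete
    T = proj₁ result

    complete : ∀ {v w} → Connected v w → label T v ≡ label T w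
    complete ε = refl
    complete (e ◅ es) =
      trans (proj₂ (proj₂ result) (∈-cartesianProduct⁺ (∈-vertices _) (∈-vertices _)) e) (complete es)

  numComponents : ℕ
  numComponents = Components.number components

Coloring : FiniteGraph → ℕ → Set
Coloring G k = V G → Fin k

monochromatic : ∀ G {k} → Coloring G k → FiniteGraph
monochromatic G c = record
  { V        = G.V
  ; _~_      = λ v w → v G.~ w × c v ≡ c w
  ; ~-sym    = λ (e , p) → G.~-sym e , sym p
  ; ~-irrefl = λ (e , _) → G.~-irrefl e
  ; _~?_     = λ v w → (v G.~? w) ×-dec (c v ≟ c w)
  ; order    = G.order
  ; enum     = G.enum
  }
  where module G = FiniteGraph G

fromℕ : ℕ → ℚ
fromℕ n = + n / 1

numBlocks : ∀ G {k} → Coloring G k → ℕ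
numBlocks G c = numComponents (monochromatic G c)

X : (k : ℕ) (G : FiniteGraph) → Coloring G k → ℚ
X k G c = fromℕ (numBlocks G c)

uniform : ∀ k .{{_ : ℕ.NonZero k}} → Fin k → ℚ
uniform k _ = + 1 / k

open import Algebra.Properties.CommutativeMonoid.Sum ℚ.+-0-commutativeMonoid public using (sum)
open import Algebra.Properties.CommutativeMonoid.Sum ℚ.*-1-commutativeMonoid public using () renaming (sum to product)

module _ (k : ℕ) (G : FiniteGraph) where
  open FiniteGraph G using (index; vertex)

  -- finToFun enumerates the functions Fin (order G) → Fin k without repetition.
  coloring : Fin (k ℕ.^ order G) → Coloring G k
  coloring j = finToFun j ∘ index

  module _ .{{_ : ℕ.NonZero k}} where

    -- Independence of the vertex colors: the probability of a coloring is the
    -- product over the vertices of the probabilities of the individual colors.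
    probability : Coloring G k → ℚ
    probability c = product λ i → uniform k (c (vertex i))

    𝔼 : (Coloring G k → ℚ) → ℚ
    𝔼 Y = sum λ j → probability (coloring j) ℚ.* Y (coloring j)

open import Algebra.Properties.Semiring.Exp (CommutativeRing.semiring ℚ.+-*-commutativeRing) public using (_^_)

infixr 8 _^ℤ_

_^ℤ_ : (p : ℚ) .{{_ : ℚ.NonZero p}} → ℤ → ℚ
p ^ℤ (+ m)    = p ^ m
p ^ℤ -[1+ m ] = (1/ p) ^ suc m

fromℕ-positive : ∀ k .{{_ : ℕ.NonZero k}} → Positive (fromℕ k)
fromℕ-positive k = ℚ.normalize-pos k 1

^-positive : ∀ p → Positive p → ∀ m → Positive (p ^ m)
^-positive p p>0 zero    = _
^-positive p p>0 (suc m) = ℚ.pos*pos⇒pos p {{p>0}} (p ^ m) {{^-positive p p>0 m}}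

fromℕ-nonZero : ∀ k .{{_ : ℕ.NonZero k}} → ℚ.NonZero (fromℕ k)
fromℕ-nonZero k = ℚ.pos⇒nonZero (fromℕ k) {{fromℕ-positive k}}

fromℕ^-nonZero : ∀ k .{{_ : ℕ.NonZero k}} m → ℚ.NonZero (fromℕ k ^ m)
fromℕ^-nonZero k m = ℚ.pos⇒nonZero (fromℕ k ^ m) {{^-positive (fromℕ k) (fromℕ-positive k) m}}

{-# OPTIONS --safe #-}
module Submission where

-- In each layer of K ℓ □ P n the vertices of one color form a clique, so a
-- block is a maximal run of consecutive layers i, i+1, … in which a color a
-- occurs and any two neighbouring layers share a column colored a in both.
-- Counting each block at its first layer, the number of blocks is the number
-- of pairs (i , a) such that a occurs in layer i and no column has color a in
-- both layers i-1 and i.  The columns are independent, so for i > 0 such a pair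
-- has probability (1 - 1/k²)^ℓ - (1 - 1/k)^ℓ, and for i = 0 it has probability
-- 1 - (1 - 1/k)^ℓ.

open import Algebra.Bundles using (CommutativeRing)
open import Data.Fin.Base using (Fin; zero; suc; toℕ; inject₁; combine; finToFun; _↑ˡ_; _↑ʳ_; splitAt)
open import Data.Fin.Induction using (<-weakInduction)
open import Data.Fin.Properties using (_≟_; any?; toℕ-injective; toℕ-inject₁; suc-injective; remQuot-combine)
open import Data.Integer.Base as ℤ using (+_)
import Data.Integer.Properties as ℤ
import Data.Integer.Solver as ℤ
open import Data.Nat.Base as ℕ using (ℕ; zero; suc; NonZero)
import Data.Nat.Properties as ℕ
open import Data.Product.Base using (∃; _×_; _,_; proj₁; proj₂)
open import Data.Rational.Base using (ℚ; 0ℚ; 1ℚ; _+_; _*_; _-_; _÷_; _/_; 1/_)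
import Data.Rational.Base as ℚ
import Data.Rational.Properties as ℚ
open import Data.Rational.Solver using (module +-*-Solver)
import Data.Rational.Unnormalised.Base as ℚᵘ
import Data.Rational.Unnormalised.Properties as ℚᵘ
open import Data.Sum.Base using (inj₁; inj₂)
open import Data.Vec.Functional using (Vector; _∷_; _++_)
open import Data.Vec.Functional.Properties using (lookup-++ˡ; lookup-++ʳ)
open import Function.Base using (_∘_)
open import Function.Bundles using (_⇔_; mk⇔; Equivalence)
open import Relation.Binary.Construct.Closure.ReflexiveTransitive using (ε; _◅_; _◅◅_; reverse)
open import Relation.Binary.PropositionalEquality
open import Relation.Nullary using (¬_; Dec; yes; no; contradiction)
open import Relation.Nullary.Decidable using (¬?; _×-dec_)
open import Defs

open import Algebra.Properties.Semiring.Sum (CommutativeRing.semiring ℚ.+-*-commutativeRing) using (sum-cong-≗; ∑-comm; ∑-distrib-+; *-distribˡ-sum; *-distribʳ-sum)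
open import Algebra.Properties.CommutativeMonoid.Sum ℚ.*-1-commutativeMonoid using () renaming (sum-cong-≗ to product-cong-≗)
open import Algebra.Properties.Semiring.Exp (CommutativeRing.semiring ℚ.+-*-commutativeRing) using (^-homo-*; ^-assocʳ)
open import Algebra.Properties.CommutativeSemiring.Exp (CommutativeRing.commutativeSemiring ℚ.+-*-commutativeRing) using (^-distrib-*)

open +-*-Solver using (solve; con; _:+_; _:*_; _:-_; _:=_)
open ≡-Reasoning

-- Rational numerals, finite sums and products

fromℕ-suc : ∀ n → fromℕ (suc n) ≡ 1ℚ + fromℕ n
-- `fromℕ n` is a fraction normalised by a gcd and does not compute for a variable `n`; among
-- unnormalised fractions the claim is an integer identity.
fromℕ-suc n = ℚ.toℚᵘ-injective (ℚᵘ.≃-trans (ℚ.toℚᵘ-fromℚᵘ (ℚᵘ.mkℚᵘ (+ suc n) 0)) (ℚᵘ.≃-sym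
  (ℚᵘ.≃-trans (ℚ.toℚᵘ-homo-+ 1ℚ (fromℕ n))
  (ℚᵘ.≃-trans (ℚᵘ.+-congʳ ℚᵘ.1ℚᵘ (ℚ.toℚᵘ-fromℚᵘ (ℚᵘ.mkℚᵘ (+ n) 0)))
  (ℚᵘ.*≡* (S.solve 1 (λ x → (S.con (+ 1) S.:* S.con (+ 1) S.:+ x S.:* S.con (+ 1)) S.:* S.con (+ 1)
                      S.:= (S.con (+ 1) S.:+ x) S.:* S.con (+ 1)) refl (+ n)))))))
  where module S = ℤ.+-*-Solver

1/k*k≡1 : ∀ k .{{_ : NonZero k}} → (+ 1 / k) * fromℕ k ≡ 1ℚ
1/k*k≡1 k@(suc k-1) = ℚ.toℚᵘ-injective
  (ℚᵘ.≃-trans (ℚ.toℚᵘ-homo-* (+ 1 / k) (fromℕ k))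
  (ℚᵘ.≃-trans (ℚᵘ.*-cong (ℚ.toℚᵘ-fromℚᵘ (ℚᵘ.mkℚᵘ (+ 1) k-1)) (ℚ.toℚᵘ-fromℚᵘ (ℚᵘ.mkℚᵘ (+ k) 0)))
  (ℚᵘ.*≡* (S.solve 1 (λ x → (S.con (+ 1) S.:* x) S.:* S.con (+ 1) S.:= S.con (+ 1) S.:* (x S.:* S.con (+ 1))) refl (+ k)))))
  where module S = ℤ.+-*-Solver

sum-const : ∀ m q → sum {m} (λ _ → q) ≡ fromℕ m * q
sum-const zero    q = sym (ℚ.*-zeroˡ q)
sum-const (suc m) q = begin
  q + sum {m} (λ _ → q)  ≡⟨ cong (_+_ q) (sum-const m q) ⟩
  q + fromℕ m * q        ≡⟨ solve 2 (λ q x → q :+ x :* q := (con 1ℚ :+ x) :* q) refl q (fromℕ m) ⟩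
  (1ℚ + fromℕ m) * q     ≡⟨ cong (_* q) (fromℕ-suc m) ⟨
  fromℕ (suc m) * q      ∎

sum-distrib-- : ∀ {m} (f g : Vector ℚ m) → sum (λ i → f i - g i) ≡ sum f - sum g
sum-distrib-- {zero}  f g = refl
sum-distrib-- {suc m} f g = begin
  (f zero - g zero) + sum (λ i → f (suc i) - g (suc i))
    ≡⟨ cong (_+_ (f zero - g zero)) (sum-distrib-- (f ∘ suc) (g ∘ suc)) ⟩
  (f zero - g zero) + (sum (f ∘ suc) - sum (g ∘ suc))
    ≡⟨ solve 4 (λ a b c d → (a :- b) :+ (c :- d) := (a :+ c) :- (b :+ d)) refl (f zero) (g zero) (sum (f ∘ suc)) (sum (g ∘ suc)) ⟩
  sum f - sum g ∎

sum-++ : ∀ m {n} (f : Vector ℚ (m ℕ.+ n)) → sum f ≡ sum (λ i → f (i ↑ˡ n)) + sum (λ j → f (m ↑ʳ j))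
sum-++ zero    f = sym (ℚ.+-identityˡ (sum f))
sum-++ (suc m) f = trans (cong (_+_ (f zero)) (sum-++ m (f ∘ suc))) (sym (ℚ.+-assoc (f zero) _ _))

sum-combine : ∀ m {n} (f : Vector ℚ (m ℕ.* n)) → sum f ≡ sum λ i → sum λ j → f (combine {m} {n} i j)
sum-combine zero        f = refl
sum-combine (suc m) {n} f = trans (sum-++ n {m ℕ.* n} f) (cong (_+_ (sum {n} (λ j → f (j ↑ˡ (m ℕ.* n))))) (sum-combine m (λ j → f (n ↑ʳ j))))

product-one : ∀ {m} (f : Vector ℚ m) → (∀ i → f i ≡ 1ℚ) → product f ≡ 1ℚ
product-one {zero}  f f≡1 = refl
product-one {suc m} f f≡1 = cong₂ _*_ (f≡1 zero) (product-one (f ∘ suc) (f≡1 ∘ suc))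

product-zero : ∀ {m} (f : Vector ℚ m) i → f i ≡ 0ℚ → product f ≡ 0ℚ
product-zero f zero    f₀≡0 = trans (cong (_* product (f ∘ suc)) f₀≡0) (ℚ.*-zeroˡ (product (f ∘ suc)))
product-zero f (suc i) fᵢ≡0 = trans (cong (f zero *_) (product-zero (f ∘ suc) i fᵢ≡0)) (ℚ.*-zeroʳ (f zero))

-- Indicators

χ : {A : Set} → Dec A → ℚ
χ (yes _) = 1ℚ
χ (no  _) = 0ℚ

χ-yes : {A : Set} (a? : Dec A) → A → χ a? ≡ 1ℚ
χ-yes (yes _) _ = refl
χ-yes (no ¬a) a = contradiction a ¬a

χ-no : {A : Set} (a? : Dec A) → ¬ A → χ a? ≡ 0ℚ
χ-no (yes a) ¬a = contradiction a ¬a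
χ-no (no _)  _  = refl

χ-cong : {A B : Set} (a? : Dec A) (b? : Dec B) → A ⇔ B → χ a? ≡ χ b?
χ-cong (yes a) b? A⇔B = sym (χ-yes b? (Equivalence.to A⇔B a))
χ-cong (no ¬a) b? A⇔B = sym (χ-no b? (¬a ∘ Equivalence.from A⇔B))

χ-× : {A B : Set} (a? : Dec A) (b? : Dec B) → χ (a? ×-dec b?) ≡ χ a? * χ b?
χ-× (yes _) (yes _) = refl
χ-× (yes _) (no  _) = refl
χ-× (no  _) (yes _) = refl
χ-× (no  _) (no  _) = refl

χ-∖ : {A B : Set} (a? : Dec A) (b? : Dec B) → (B → A) → χ (a? ×-dec ¬? b?) ≡ χ a? - χ b?
χ-∖ (yes _) (yes _) B⊆A = refl
χ-∖ (yes _) (no  _) B⊆A = refl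
χ-∖ (no ¬a) (yes b) B⊆A = contradiction (B⊆A b) ¬a
χ-∖ (no  _) (no  _) B⊆A = refl

-- The product is the indicator that no `A i` holds: a true instance makes its factor zero, and
-- otherwise all factors are one. In this form independence can act on it.
χ-∃ : ∀ {m} {A : Fin m → Set} (a? : ∀ i → Dec (A i)) (∃a? : Dec (∃ A)) →
      χ ∃a? ≡ 1ℚ - product λ i → 1ℚ - χ (a? i)
χ-∃ a? (yes (i , a)) = cong (_-_ 1ℚ) (sym (product-zero _ i (cong (_-_ 1ℚ) (χ-yes (a? i) a))))
χ-∃ a? (no ∄a)       = cong (_-_ 1ℚ) (sym (product-one _ λ i → cong (_-_ 1ℚ) (χ-no (a? i) λ a → ∄a (i , a))))

sum-χ-none : ∀ {m} {A : Fin m → Set} (a? : ∀ i → Dec (A i)) → ¬ ∃ A → sum (λ i → χ (a? i)) ≡ 0ℚ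
sum-χ-none {zero}  a? ∄a = refl
sum-χ-none {suc m} a? ∄a = cong₂ _+_ (χ-no (a? zero) λ a → ∄a (zero , a))
                                     (sum-χ-none (a? ∘ suc) λ (i , a) → ∄a (suc i , a))

sum-χ-unique : ∀ {m} {A : Fin m → Set} (a? : ∀ i → Dec (A i)) i → A i → (∀ {j} → A j → j ≡ i) →
               sum (λ i → χ (a? i)) ≡ 1ℚ
sum-χ-unique a? zero    a unique = cong₂ _+_ (χ-yes (a? zero) a)
  (sum-χ-none (a? ∘ suc) λ (_ , b) → contradiction (unique b) λ ())
sum-χ-unique a? (suc i) a unique = cong₂ _+_ (χ-no (a? zero) λ b → contradiction (unique b) λ ())
  (sum-χ-unique (a? ∘ suc) i a (suc-injective ∘ unique))

sum-χ : ∀ {m} {A : Fin m → Set} (a? : ∀ i → Dec (A i)) (∃a? : Dec (∃ A)) →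
        (∀ {i j} → A i → A j → i ≡ j) → sum (λ i → χ (a? i)) ≡ χ ∃a?
sum-χ a? (yes (i , a)) unique = sum-χ-unique a? i a (λ b → unique b a)
sum-χ a? (no ∄a)       unique = sum-χ-none a? ∄a

-- Counting components by a complete invariant

count-image : ∀ {N m k} (g : Fin N → Fin m × Fin k) → (∀ {x y} → g x ≡ g y → x ≡ y) →
              {H : Fin m → Fin k → Set} (H? : ∀ i a → Dec (H i a)) →
              (∀ i a → H i a ⇔ ∃ λ y → g y ≡ (i , a)) →
              (sum λ i → sum λ a → χ (H? i a)) ≡ fromℕ N
count-image {N} g g-injective H? H⇔ = begin
  (sum λ i → sum λ a → χ (H? i a))
    -- Double counting: `H?` marks the image of the injection `g`, so its indicator equals the
    -- number of preimages; with the sum over `y` moved outside, each `y` contributes one.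
    ≡⟨ sum-cong-≗ (λ i → sum-cong-≗ λ a → fibre i a) ⟩
  (sum λ i → sum λ a → sum λ y → χ (g? y i a))
    ≡⟨ sum-cong-≗ (λ i → ∑-comm λ a y → χ (g? y i a)) ⟩
  (sum λ i → sum λ y → sum λ a → χ (g? y i a))
    ≡⟨ ∑-comm (λ i y → sum λ a → χ (g? y i a)) ⟩
  (sum λ y → sum λ i → sum λ a → χ (g? y i a))
    ≡⟨ sum-cong-≗ one ⟩
  sum {N} (λ _ → 1ℚ)
    ≡⟨ sum-const N 1ℚ ⟩
  fromℕ N * 1ℚ
    ≡⟨ ℚ.*-identityʳ (fromℕ N) ⟩
  fromℕ N ∎
  where
  g? : ∀ y i a → Dec (proj₁ (g y) ≡ i × proj₂ (g y) ≡ a)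
  g? y i a = (proj₁ (g y) ≟ i) ×-dec (proj₂ (g y) ≟ a)

  fibre : ∀ i a → χ (H? i a) ≡ sum λ y → χ (g? y i a)
  fibre i a = trans (χ-cong (H? i a) (any? λ y → g? y i a) (mk⇔
      (λ h → let y , gy≡ = Equivalence.to (H⇔ i a) h in y , cong proj₁ gy≡ , cong proj₂ gy≡)
      (λ (y , p , q) → Equivalence.from (H⇔ i a) (y , cong₂ _,_ p q))))
    (sym (sum-χ (λ y → g? y i a) (any? λ y → g? y i a)
      λ (p , q) (p′ , q′) → g-injective (cong₂ _,_ (trans p (sym p′)) (trans q (sym q′)))))

  one : ∀ y → (sum λ i → sum λ a → χ (g? y i a)) ≡ 1ℚ
  one y = begin
    (sum λ i → sum λ a → χ (g? y i a))
      ≡⟨ sum-cong-≗ (λ i → trans (sum-cong-≗ λ a → χ-× (p? i) (q? a)) (sym (*-distribˡ-sum (χ (p? i)) (λ a → χ (q? a))))) ⟩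
    (sum λ i → χ (p? i) * sum λ a → χ (q? a))
      ≡⟨ sum-cong-≗ (λ i → trans (cong (χ (p? i) *_) (sum-χ-unique q? _ refl sym)) (ℚ.*-identityʳ (χ (p? i)))) ⟩
    (sum λ i → χ (p? i))
      ≡⟨ sum-χ-unique p? _ refl sym ⟩
    1ℚ ∎
    where
    p? = λ i → proj₁ (g y) ≟ i
    q? = λ a → proj₂ (g y) ≟ a

-- Restricting the invariant `r` to one representative per component makes it injective without
-- shrinking its image, so the image has `number` elements.
number-of-components : ∀ {G m k} (C : Components G) (r : FiniteGraph.V G → Fin m × Fin k) →
                       (∀ v w → r v ≡ r w ⇔ Connected G v w) →
                       {H : Fin m → Fin k → Set} (H? : ∀ i a → Dec (H i a)) →
                       (∀ i a → H i a ⇔ ∃ λ v → r v ≡ (i , a)) →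
                       (sum λ i → sum λ a → χ (H? i a)) ≡ fromℕ (Components.number C)
number-of-components {G} C r r⇔ H? H⇔ = count-image (r ∘ rep) injective H? λ i a → mk⇔
  -- A value attained at `v` is attained at the representative of its component too, because `r` is
  -- constant on components.
  (λ h → let v , rv≡ = Equivalence.to (H⇔ i a) h in
    component v , trans (Equivalence.from (r⇔ _ _) (Equivalence.to (connected _ _) (component-rep (component v)))) rv≡)
  (λ (y , p) → Equivalence.from (H⇔ i a) (rep y , p))
  where
  open Components C

  rep : Fin number → FiniteGraph.V G
  rep y = proj₁ (surjective y)

  component-rep : ∀ y → component (rep y) ≡ y
  component-rep y = proj₂ (surjective y) refl

  injective : ∀ {x y} → r (rep x) ≡ r (rep y) → x ≡ y
  injective {x} {y} p = begin
    x                  ≡⟨ component-rep x ⟨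
    component (rep x)  ≡⟨ Equivalence.from (connected _ _) (Equivalence.to (r⇔ _ _) p) ⟩
    component (rep y)  ≡⟨ component-rep y ⟩
    y                  ∎

-- Blocks of a coloring of K ℓ □ P (suc n)

module _ {ℓ n k} (c : Coloring (K ℓ □ P (suc n)) k) where

  private
    G = monochromatic (K ℓ □ P (suc n)) c

  Occurs : Fin (suc n) → Fin k → Set
  Occurs i a = ∃ λ v → c (v , i) ≡ a

  Linked : Fin n → Fin k → Set
  Linked i a = ∃ λ v → c (v , inject₁ i) ≡ a × c (v , suc i) ≡ a

  Head : Fin (suc n) → Fin k → Set
  Head zero    a = Occurs zero a
  Head (suc i) a = Occurs (suc i) a × ¬ Linked i a

  occurs? : ∀ i a → Dec (Occurs i a)
  occurs? i a = any? λ v → c (v , i) ≟ a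

  linked? : ∀ i a → Dec (Linked i a)
  linked? i a = any? λ v → (c (v , inject₁ i) ≟ a) ×-dec (c (v , suc i) ≟ a)

  head? : ∀ i a → Dec (Head i a)
  head? zero    a = occurs? zero a
  head? (suc i) a = occurs? (suc i) a ×-dec ¬? (linked? i a)

  head⇒occurs : ∀ {i a} → Head i a → Occurs i a
  head⇒occurs {zero}  h = h
  head⇒occurs {suc i} h = proj₁ h

  -- Run a s i: the block containing the color a in layer i starts in layer s.
  data Run (a : Fin k) : Fin (suc n) → Fin (suc n) → Set where
    here : ∀ {i} → Head i a → Run a i i
    step : ∀ {s i} → Linked i a → Run a s (inject₁ i) → Run a s (suc i)

  run-head : ∀ {a s i} → Run a s i → Head s a
  run-head (here h)   = h
  run-head (step _ r) = run-head r

  -- In a layer `suc i` the constructor is forced, since `step` needs a link and a head there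
  -- forbids it; in layer `zero` only `here` applies.
  run-unique : ∀ {a s t i} → Run a s i → Run a t i → s ≡ t
  run-unique (here _)       (here _)       = refl
  run-unique (here (_ , ¬l)) (step l _)    = contradiction l ¬l
  run-unique (step l _)     (here (_ , ¬l)) = contradiction l ¬l
  run-unique (step _ r)     (step _ r′)    = run-unique r r′

  -- The witness of a link is also an occurrence in the preceding layer, so the induction hypothesis
  -- applies; without a link the layer is itself a head.
  run-exists : ∀ i {a} → Occurs i a → ∃ λ s → Run a s i
  run-exists = <-weakInduction (λ i → ∀ {a} → Occurs i a → ∃ λ s → Run a s i)
    (λ o → zero , here o)
    (λ i rec {a} o → next i rec o (linked? i a))
    where
    next : ∀ i → (∀ {a} → Occurs (inject₁ i) a → ∃ λ s → Run a s (inject₁ i)) →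
           ∀ {a} → Occurs (suc i) a → Dec (Linked i a) → ∃ λ s → Run a s (suc i)
    next i rec o (yes l@(v , p , _)) = let s , r = rec (v , p) in s , step l r
    next i rec o (no ¬l)             = suc i , here (o , ¬l)

  connected-in-layer : ∀ {v w} i → c (v , i) ≡ c (w , i) → Connected G (v , i) (w , i)
  connected-in-layer {v} {w} i p with v ≟ w
  ... | yes refl = ε
  ... | no v≢w   = (inj₂ (refl , v≢w) , p) ◅ ε

  run-connected : ∀ {a s i v w} → Run a s i → c (v , i) ≡ a → c (w , s) ≡ a → Connected G (v , i) (w , s)
  run-connected {i = i} (here _) p q = connected-in-layer i (trans p (sym q))
  run-connected {v = v} {w} (step {i = i} (u , p′ , q′) r) p q =
    -- Move inside the clique of color `a` to the linking column `u`, cross the edge from `suc i`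
    -- back to `inject₁ i`, and continue along the shorter run.
    connected-in-layer {v} {u} (suc i) (trans p (sym q′)) ◅◅
    (inj₁ (refl , inj₂ (cong suc (sym (toℕ-inject₁ i)))) , trans q′ (sym p′)) ◅
    run-connected r p′ q

  run-next : ∀ {v a i j s t} → toℕ j ≡ suc (toℕ i) → c (v , i) ≡ a → c (v , j) ≡ a →
             Run a s i → Run a t j → s ≡ t
  run-next {i = i} {suc j} j≡1+i p q r r′
    -- Adjacency in the path is stated through `toℕ`; once `i` is identified with `inject₁ j`, the
    -- column `v` is a link that extends `r` to layer `suc j`.
    with refl ← toℕ-injective {i = i} {inject₁ j} (trans (sym (ℕ.suc-injective j≡1+i)) (sym (toℕ-inject₁ j)))
    = run-unique (step (_ , p , q) r) r′

  root-layer : ∀ v i → ∃ λ s → Run (c (v , i)) s i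
  root-layer v i = run-exists i (v , refl)

  -- The complete invariant of blocks to which `number-of-components` is applied.
  root : Fin ℓ × Fin (suc n) → Fin (suc n) × Fin k
  root (v , i) = proj₁ (root-layer v i) , c (v , i)

  -- An edge between two layers is itself a link, so the run of one endpoint extends to the other;
  -- for an edge within a layer, uniqueness of the run suffices.
  root-edge : ∀ x y → FiniteGraph._~_ G x y → root x ≡ root y
  root-edge (v , i) (w , j) (e , p) = cong₂ _,_ (layer e (proj₂ (root-layer w j))) p
    where
    -- The endpoints agree in color only up to `p`, so the first run is transported to the color of
    -- the second before they are compared.
    r : Run (c (w , j)) (proj₁ (root-layer v i)) i
    r = subst (λ a → Run a (proj₁ (root-layer v i)) i) p (proj₂ (root-layer v i))

    layer : ∀ {t} → FiniteGraph._~_ (K ℓ □ P (suc n)) (v , i) (w , j) → Run (c (w , j)) t j →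
            proj₁ (root-layer v i) ≡ t
    layer (inj₁ (refl , inj₁ j≡1+i)) r′ = run-next j≡1+i p refl r r′
    layer (inj₁ (refl , inj₂ i≡1+j)) r′ = sym (run-next i≡1+j refl p r′ r)
    layer (inj₂ (refl , _))          r′ = run-unique r r′

  root-connected : ∀ x y → Connected G x y → root x ≡ root y
  root-connected x .x ε                  = refl
  root-connected x z  (_◅_ {j = y} e es) = trans (root-edge x y e) (root-connected y z es)

  -- Each vertex walks back along its run. Equal roots make both runs end in the same layer with the
  -- same color, so one occurrence `o` there is a common endpoint.
  connected-root : ∀ x y → root x ≡ root y → Connected G x y
  connected-root (v , i) (w , j) p = to-head ◅◅ reverse (FiniteGraph.~-sym G) from-head
    where
    r = proj₂ (root-layer v i)
    o = head⇒occurs (run-head r)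

    to-head : Connected G (v , i) (proj₁ o , proj₁ (root-layer v i))
    to-head = run-connected r refl (proj₂ o)

    from-head : Connected G (w , j) (proj₁ o , proj₁ (root-layer v i))
    from-head = run-connected (subst (λ s → Run _ s j) (sym (cong proj₁ p)) (proj₂ (root-layer w j)))
                              refl (trans (proj₂ o) (cong proj₂ p))

  -- A head is the root of its own vertices, by the run `here`; conversely every run starts at a
  -- head.
  head⇔root : ∀ i a → Head i a ⇔ ∃ λ x → root x ≡ (i , a)
  head⇔root i a = mk⇔
    (λ h → let v , p = head⇒occurs h in
      (v , i) , cong₂ _,_ (run-unique (proj₂ (root-layer v i)) (here (subst (Head i) (sym p) h))) p)
    (λ { ((v , j) , refl) → run-head (proj₂ (root-layer v j)) })

  numBlocks≡heads : fromℕ (numBlocks (K ℓ □ P (suc n)) c) ≡ sum λ i → sum λ a → χ (head? i a)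
  numBlocks≡heads = sym (number-of-components (components G) root
    (λ x y → mk⇔ (connected-root x y) (root-connected x y)) head? head⇔root)

  -- The block count as sums of products over columns

  absent : Fin (suc n) → Fin k → ℚ
  absent i a = product λ v → 1ℚ - χ (c (v , i) ≟ a)

  unlinked : Fin n → Fin k → ℚ
  unlinked i a = product λ v → 1ℚ - χ (c (v , inject₁ i) ≟ a) * χ (c (v , suc i) ≟ a)

  -- Every product has one factor per column, ready for independence. Written in color values alone,
  -- the count also visibly respects pointwise equality of colorings.
  blocks : ℚ
  blocks = (sum λ a → 1ℚ - absent zero a) + (sum λ i → sum λ a → unlinked i a - absent (suc i) a)

  χ-head-zero : ∀ a → χ (head? zero a) ≡ 1ℚ - absent zero a
  χ-head-zero a = χ-∃ (λ v → c (v , zero) ≟ a) (occurs? zero a)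

  χ-head-suc : ∀ i a → χ (head? (suc i) a) ≡ unlinked i a - absent (suc i) a
  χ-head-suc i a = begin
    χ (head? (suc i) a)
      -- A link already contains an occurrence in the later layer, so the difference of events
      -- becomes a subtraction.
      ≡⟨ χ-∖ (occurs? (suc i) a) (linked? i a) (λ (v , _ , q) → v , q) ⟩
    χ (occurs? (suc i) a) - χ (linked? i a)
      ≡⟨ cong₂ _-_ (χ-∃ (λ v → c (v , suc i) ≟ a) (occurs? (suc i) a)) (trans (χ-∃ l? (linked? i a))
           (cong (_-_ 1ℚ) (product-cong-≗ λ v → cong (_-_ 1ℚ) (χ-× (c (v , inject₁ i) ≟ a) (c (v , suc i) ≟ a))))) ⟩
    (1ℚ - absent (suc i) a) - (1ℚ - unlinked i a)
      ≡⟨ solve 2 (λ x y → (con 1ℚ :- x) :- (con 1ℚ :- y) := y :- x) refl (absent (suc i) a) (unlinked i a) ⟩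
    unlinked i a - absent (suc i) a ∎
    where
    l? : ∀ v → Dec (c (v , inject₁ i) ≡ a × c (v , suc i) ≡ a)
    l? v = (c (v , inject₁ i) ≟ a) ×-dec (c (v , suc i) ≟ a)

  numBlocks≡blocks : fromℕ (numBlocks (K ℓ □ P (suc n)) c) ≡ blocks
  numBlocks≡blocks = trans numBlocks≡heads
    (cong₂ _+_ (sum-cong-≗ χ-head-zero) (sum-cong-≗ λ i → sum-cong-≗ (χ-head-suc i)))

-- Expectations

module _ (k : ℕ) .{{_ : NonZero k}} where

  private
    ρ : ℚ
    ρ = + 1 / k

  mean : (Fin k → ℚ) → ℚ
  mean g = sum λ x → ρ * g x

  mean-cong : ∀ {g h} → g ≗ h → mean g ≡ mean h
  mean-cong g≗h = sum-cong-≗ λ x → cong (ρ *_) (g≗h x)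

  mean-const : ∀ q → mean (λ _ → q) ≡ q
  mean-const q = begin
    sum {k} (λ _ → ρ * q)  ≡⟨ sum-const k (ρ * q) ⟩
    fromℕ k * (ρ * q)      ≡⟨ solve 3 (λ x y z → x :* (y :* z) := (y :* x) :* z) refl (fromℕ k) ρ q ⟩
    (ρ * fromℕ k) * q      ≡⟨ cong (_* q) (1/k*k≡1 k) ⟩
    1ℚ * q                 ≡⟨ ℚ.*-identityˡ q ⟩
    q                      ∎

  mean-*ʳ : ∀ g q → mean (λ x → g x * q) ≡ mean g * q
  mean-*ʳ g q = trans (sum-cong-≗ λ x → sym (ℚ.*-assoc ρ (g x) q)) (sym (*-distribʳ-sum q (λ x → ρ * g x)))

  mean-*ˡ : ∀ q g → mean (λ x → q * g x) ≡ q * mean g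
  mean-*ˡ q g = begin
    mean (λ x → q * g x)  ≡⟨ mean-cong (λ x → ℚ.*-comm q (g x)) ⟩
    mean (λ x → g x * q)  ≡⟨ mean-*ʳ g q ⟩
    mean g * q            ≡⟨ ℚ.*-comm (mean g) q ⟩
    q * mean g            ∎

  mean-+ : ∀ g h → mean (λ x → g x + h x) ≡ mean g + mean h
  mean-+ g h = trans (sum-cong-≗ λ x → ℚ.*-distribˡ-+ ρ (g x) (h x)) (∑-distrib-+ (λ x → ρ * g x) (λ x → ρ * h x))

  mean-- : ∀ g h → mean (λ x → g x - h x) ≡ mean g - mean h
  mean-- g h = trans
    (sum-cong-≗ λ x → solve 3 (λ r y z → r :* (y :- z) := r :* y :- r :* z) refl ρ (g x) (h x))
    (sum-distrib-- (λ x → ρ * g x) (λ x → ρ * h x))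

  mean-sum : ∀ {m} (g : Fin m → Fin k → ℚ) → mean (λ x → sum λ i → g i x) ≡ sum λ i → mean (g i)
  mean-sum g = trans (sum-cong-≗ λ x → *-distribˡ-sum ρ (λ i → g i x)) (∑-comm (λ x i → ρ * g i x))

  mean-χ : ∀ a → mean (λ x → χ (x ≟ a)) ≡ ρ
  mean-χ a = begin
    mean (λ x → χ (x ≟ a))     ≡⟨ *-distribˡ-sum ρ (λ x → χ (x ≟ a)) ⟨
    ρ * sum (λ x → χ (x ≟ a))  ≡⟨ cong (ρ *_) (sum-χ-unique (_≟ a) a refl (λ p → p)) ⟩
    ρ * 1ℚ                     ≡⟨ ℚ.*-identityʳ ρ ⟩
    ρ                          ∎

  -- Uniform expectation as iterated averages, one coordinate at a time, so that linearity and
  -- independence go by induction on the length; `sum-finToFun` ties it to the enumeration in `𝔼`.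
  E : ∀ m → (Vector (Fin k) m → ℚ) → ℚ
  E zero    F = F λ ()
  E (suc m) F = mean λ x → E m λ f → F (x ∷ f)

  -- Vectors are functions, and splitting or rebuilding them yields only pointwise equalities, which
  -- `F` must respect.
  Extensional : ∀ {m} → (Vector (Fin k) m → ℚ) → Set
  Extensional F = ∀ {f g} → f ≗ g → F f ≡ F g

  ∷-cong : ∀ {m} x {f g : Vector (Fin k) m} → f ≗ g → (x ∷ f) ≗ (x ∷ g)
  ∷-cong x f≗g zero    = refl
  ∷-cong x f≗g (suc i) = f≗g i

  E-cong : ∀ m {F G : Vector (Fin k) m → ℚ} → F ≗ G → E m F ≡ E m G
  E-cong zero    F≗G = F≗G _
  E-cong (suc m) F≗G = mean-cong λ x → E-cong m λ f → F≗G (x ∷ f)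

  E-const : ∀ m q → E m (λ _ → q) ≡ q
  E-const zero    q = refl
  E-const (suc m) q = trans (mean-cong λ _ → E-const m q) (mean-const q)

  E-*ˡ : ∀ m q F → E m (λ f → q * F f) ≡ q * E m F
  E-*ˡ zero    q F = refl
  E-*ˡ (suc m) q F = trans (mean-cong λ x → E-*ˡ m q (λ f → F (x ∷ f))) (mean-*ˡ q _)

  E-*ʳ : ∀ m F q → E m (λ f → F f * q) ≡ E m F * q
  E-*ʳ zero    F q = refl
  E-*ʳ (suc m) F q = trans (mean-cong λ x → E-*ʳ m (λ f → F (x ∷ f)) q) (mean-*ʳ _ q)

  E-- : ∀ m F G → E m (λ f → F f - G f) ≡ E m F - E m G
  E-- zero    F G = refl
  E-- (suc m) F G = trans (mean-cong λ x → E-- m (λ f → F (x ∷ f)) (λ f → G (x ∷ f))) (mean-- _ _)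

  E-sum : ∀ m {p} (F : Fin p → Vector (Fin k) m → ℚ) → E m (λ f → sum λ i → F i f) ≡ sum λ i → E m (F i)
  E-sum zero    F = refl
  E-sum (suc m) F = trans (mean-cong λ x → E-sum m (λ i f → F i (x ∷ f))) (mean-sum λ i x → E m λ f → F i (x ∷ f))

  E-+ : ∀ m F G → E m (λ f → F f + G f) ≡ E m F + E m G
  E-+ zero    F G = refl
  E-+ (suc m) F G = trans (mean-cong λ x → E-+ m (λ f → F (x ∷ f)) (λ f → G (x ∷ f))) (mean-+ _ _)

  finToFun-combine : ∀ {m} x (j : Fin (k ℕ.^ m)) → finToFun {k} {suc m} (combine x j) ≗ (x ∷ finToFun j)
  finToFun-combine {m} x j zero    = cong proj₁ (remQuot-combine x j)
  finToFun-combine {m} x j (suc i) = cong (λ p → finToFun (proj₂ p) i) (remQuot-combine {k} x j)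

  -- An index below `k ^ suc m` has the form `combine x j`, with `x` the first color and `j` coding
  -- the others; the weight `ρ` of `x` splits off and forms the outer mean.
  sum-finToFun : ∀ m {F : Vector (Fin k) m → ℚ} → Extensional F →
                 (sum {k ℕ.^ m} λ j → product {m} (λ _ → ρ) * F (finToFun j)) ≡ E m F
  sum-finToFun zero {F} ext = begin
    1ℚ * F (finToFun zero) + 0ℚ  ≡⟨ solve 1 (λ x → con 1ℚ :* x :+ con 0ℚ := x) refl (F (finToFun zero)) ⟩
    F (finToFun zero)            ≡⟨ ext (λ ()) ⟩
    F (λ ())                     ∎
  sum-finToFun (suc m) {F} ext = begin
    (sum {k ℕ.^ suc m} λ j → (ρ * Π) * F (finToFun j))
      ≡⟨ sum-combine k {k ℕ.^ m} (λ j → (ρ * Π) * F (finToFun j)) ⟩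
    (sum {k} λ x → sum {k ℕ.^ m} λ j → (ρ * Π) * F (finToFun (combine x j)))
      ≡⟨ sum-cong-≗ (λ x → sum-cong-≗ λ j → trans (cong ((ρ * Π) *_) (ext (finToFun-combine x j))) (ℚ.*-assoc ρ Π _)) ⟩
    (sum {k} λ x → sum {k ℕ.^ m} λ j → ρ * (Π * F (x ∷ finToFun j)))
      ≡⟨ sum-cong-≗ (λ x → *-distribˡ-sum ρ (λ j → Π * F (x ∷ finToFun j))) ⟨
    mean (λ x → sum {k ℕ.^ m} λ j → Π * F (x ∷ finToFun j))
      ≡⟨ mean-cong (λ x → sum-finToFun m (λ f≗g → ext (∷-cong x f≗g))) ⟩
    E (suc m) F ∎
    where
    Π : ℚ
    Π = product {m} (λ _ → ρ)

  E-++ : ∀ m n {F : Vector (Fin k) (m ℕ.+ n) → ℚ} → Extensional F →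
         E (m ℕ.+ n) F ≡ E m λ f → E n λ g → F (f ++ g)
  E-++ zero    n     ext = refl
  E-++ (suc m) n {F} ext = mean-cong λ x → trans (E-++ m n λ f≗g → ext (∷-cong x f≗g))
                                                 (E-cong m λ f → E-cong n λ g → ext (∷-++ x f g))
    where
    ∷-++ : ∀ x (f : Vector (Fin k) m) (g : Vector (Fin k) n) → (x ∷ (f ++ g)) ≗ ((x ∷ f) ++ g)
    ∷-++ x f g zero = refl
    ∷-++ x f g (suc i) with splitAt m i
    ... | inj₁ _ = refl
    ... | inj₂ _ = refl

  -- Independence of the columns. `combine v i` places the `n` entries of a column consecutively, so
  -- splitting off the first `n` coordinates by `E-++` isolates one factor `E n φ`.
  E-columns : ∀ ℓ n {φ : Vector (Fin k) n → ℚ} → Extensional φ →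
              E (ℓ ℕ.* n) (λ f → product λ v → φ (λ i → f (combine {ℓ} {n} v i))) ≡ E n φ ^ ℓ
  E-columns zero    n     ext = refl
  E-columns (suc ℓ) n {φ} ext = begin
    E (n ℕ.+ ℓ ℕ.* n) (λ f → product λ v → φ (λ i → f (combine {suc ℓ} {n} v i)))
      ≡⟨ E-++ n (ℓ ℕ.* n) (λ f≗g → product-cong-≗ λ v → ext λ i → f≗g (combine {suc ℓ} {n} v i)) ⟩
    E n (λ f → E (ℓ ℕ.* n) λ g → φ (λ i → (f ++ g) (i ↑ˡ _)) * product λ v → φ (λ i → (f ++ g) (n ↑ʳ combine {ℓ} {n} v i)))
      ≡⟨ E-cong n (λ f → E-cong (ℓ ℕ.* n) λ g → cong₂ _*_ (ext (lookup-++ˡ f g))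
           (product-cong-≗ λ v → ext λ i → lookup-++ʳ f g (combine {ℓ} {n} v i))) ⟩
    E n (λ f → E (ℓ ℕ.* n) λ g → φ f * product λ v → φ (λ i → g (combine {ℓ} {n} v i)))
      ≡⟨ E-cong n (λ f → trans (E-*ˡ (ℓ ℕ.* n) (φ f) _) (cong (φ f *_) (E-columns ℓ n ext))) ⟩
    E n (λ f → φ f * E n φ ^ ℓ)
      ≡⟨ E-*ʳ n φ (E n φ ^ ℓ) ⟩
    E n φ * E n φ ^ ℓ ∎

  E-marginal : ∀ {m} (p : Fin m) (g : Fin k → ℚ) → E m (λ f → g (f p)) ≡ mean g
  E-marginal {suc m} zero    g = mean-cong λ x → E-const m (g x)
  E-marginal {suc m} (suc p) g = trans (mean-cong λ _ → E-marginal p g) (mean-const (mean g))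

  -- Induction down to the earlier coordinate: its factor is constant for the averages over later
  -- ones, and `E-marginal` handles the other factor.
  E-marginal₂ : ∀ {m} (p q : Fin m) → p ≢ q → (g h : Fin k → ℚ) →
                E m (λ f → g (f p) * h (f q)) ≡ mean g * mean h
  E-marginal₂         zero    zero    p≢q g h = contradiction refl p≢q
  E-marginal₂ {suc m} zero    (suc q) p≢q g h = trans
    (mean-cong λ x → trans (E-*ˡ m (g x) (λ f → h (f q))) (cong (g x *_) (E-marginal q h))) (mean-*ʳ g (mean h))
  E-marginal₂ {suc m} (suc p) zero    p≢q g h = trans
    (mean-cong λ x → trans (E-*ʳ m (λ f → g (f p)) (h x)) (cong (_* h x) (E-marginal p g))) (mean-*ˡ (mean g) h)
  E-marginal₂         (suc p) (suc q) p≢q g h = trans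
    (mean-cong λ _ → E-marginal₂ p q (p≢q ∘ cong suc) g h) (mean-const (mean g * mean h))

  -- The expected number of blocks

  module _ (ℓ n : ℕ) where

    private
      M = ℓ ℕ.* suc n

    fromVector : Vector (Fin k) M → Coloring (K ℓ □ P (suc n)) k
    fromVector f (v , i) = f (combine v i)

    E-absent : ∀ i a → E M (λ f → absent (fromVector f) i a) ≡ (1ℚ - ρ) ^ ℓ
    E-absent i a = trans (E-columns ℓ (suc n) λ f≗g → cong (λ x → 1ℚ - χ (x ≟ a)) (f≗g i)) (cong (_^ ℓ) (begin
      E (suc n) (λ f → 1ℚ - χ (f i ≟ a))  ≡⟨ E-marginal i (λ x → 1ℚ - χ (x ≟ a)) ⟩
      mean (λ x → 1ℚ - χ (x ≟ a))         ≡⟨ mean-- _ _ ⟩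
      mean (λ _ → 1ℚ) - mean (λ x → χ (x ≟ a)) ≡⟨ cong₂ _-_ (mean-const 1ℚ) (mean-χ a) ⟩
      1ℚ - ρ ∎))

    E-unlinked : ∀ i a → E M (λ f → unlinked (fromVector f) i a) ≡ (1ℚ - ρ * ρ) ^ ℓ
    E-unlinked i a = trans
      (E-columns ℓ (suc n) λ f≗g → cong₂ (λ x y → 1ℚ - χ (x ≟ a) * χ (y ≟ a)) (f≗g (inject₁ i)) (f≗g (suc i)))
      (cong (_^ ℓ) (begin
        E (suc n) (λ f → 1ℚ - χ (f (inject₁ i) ≟ a) * χ (f (suc i) ≟ a))
          ≡⟨ E-- (suc n) (λ _ → 1ℚ) (λ f → χ (f (inject₁ i) ≟ a) * χ (f (suc i) ≟ a)) ⟩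
        E (suc n) (λ _ → 1ℚ) - E (suc n) (λ f → χ (f (inject₁ i) ≟ a) * χ (f (suc i) ≟ a))
          -- Two neighbouring layers of a column are distinct coordinates, hence independent, and
          -- the mean of the product is a product of means.
          ≡⟨ cong₂ _-_ (E-const (suc n) 1ℚ) (E-marginal₂ (inject₁ i) (suc i) inject₁≢suc (λ x → χ (x ≟ a)) (λ x → χ (x ≟ a))) ⟩
        1ℚ - mean (λ x → χ (x ≟ a)) * mean (λ x → χ (x ≟ a))
          ≡⟨ cong (λ z → 1ℚ - z * z) (mean-χ a) ⟩
        1ℚ - ρ * ρ ∎))
      where
      inject₁≢suc : inject₁ i ≢ suc i
      inject₁≢suc p = ℕ.1+n≢n (trans (cong toℕ (sym p)) (toℕ-inject₁ i))

    -- The path has `suc n` layers: the first summand belongs to layer `zero`, and `n` counts the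
    -- layers that have a predecessor.
    expected : ℚ
    expected = fromℕ k * (1ℚ - (1ℚ - ρ) ^ ℓ) + fromℕ n * (fromℕ k * ((1ℚ - ρ * ρ) ^ ℓ - (1ℚ - ρ) ^ ℓ))

    E-blocks : E M (λ f → blocks (fromVector f)) ≡ expected
    E-blocks = begin
      E M (λ f → blocks (fromVector f))
        ≡⟨ E-+ M _ _ ⟩
      E M (λ f → sum λ a → 1ℚ - absent (fromVector f) zero a) +
      E M (λ f → sum λ i → sum λ a → unlinked (fromVector f) i a - absent (fromVector f) (suc i) a)
        ≡⟨ cong₂ _+_
             (E-sum M λ a f → 1ℚ - absent (fromVector f) zero a)
             (trans (E-sum M λ i f → sum λ a → unlinked (fromVector f) i a - absent (fromVector f) (suc i) a)
                    (sum-cong-≗ λ i → E-sum M λ a f → unlinked (fromVector f) i a - absent (fromVector f) (suc i) a)) ⟩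
      (sum λ a → E M (λ f → 1ℚ - absent (fromVector f) zero a)) +
      (sum λ i → sum λ a → E M (λ f → unlinked (fromVector f) i a - absent (fromVector f) (suc i) a))
        ≡⟨ cong₂ _+_
             (sum-cong-≗ λ a → trans (E-- M _ _) (cong₂ _-_ (E-const M 1ℚ) (E-absent zero a)))
             (sum-cong-≗ λ i → sum-cong-≗ λ a → trans (E-- M _ _) (cong₂ _-_ (E-unlinked i a) (E-absent (suc i) a))) ⟩
      sum {k} (λ _ → 1ℚ - (1ℚ - ρ) ^ ℓ) + sum {n} (λ _ → sum {k} λ _ → (1ℚ - ρ * ρ) ^ ℓ - (1ℚ - ρ) ^ ℓ)
        ≡⟨ cong₂ _+_ (sum-const k _) (trans (sum-const n _) (cong (fromℕ n *_) (sum-const k _))) ⟩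
      expected ∎

    absent-extensional : ∀ i a → Extensional (λ f → absent (fromVector f) i a)
    absent-extensional i a f≗g = product-cong-≗ {ℓ} λ v → cong (λ x → 1ℚ - χ (x ≟ a)) (f≗g (combine v i))

    unlinked-extensional : ∀ i a → Extensional (λ f → unlinked (fromVector f) i a)
    unlinked-extensional i a f≗g = product-cong-≗ {ℓ} λ v →
      cong₂ (λ x y → 1ℚ - χ (x ≟ a) * χ (y ≟ a)) (f≗g (combine v (inject₁ i))) (f≗g (combine v (suc i)))

    blocks-extensional : Extensional (λ f → blocks (fromVector f))
    blocks-extensional f≗g = cong₂ _+_
      (sum-cong-≗ {k} λ a → cong (_-_ 1ℚ) (absent-extensional zero a f≗g))
      (sum-cong-≗ {n} λ i → sum-cong-≗ {k} λ a →
        cong₂ _-_ (unlinked-extensional i a f≗g) (absent-extensional (suc i) a f≗g))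

    𝔼-blocks : 𝔼 k (K ℓ □ P (suc n)) (X k (K ℓ □ P (suc n))) ≡ expected
    𝔼-blocks = begin
      𝔼 k (K ℓ □ P (suc n)) (X k (K ℓ □ P (suc n)))
        -- The probability and `coloring j` unfold by computation to the constant product of `ρ` and
        -- to `fromVector (finToFun j)`, so only the block count is rewritten.
        ≡⟨ sum-cong-≗ (λ j → cong (product {M} (λ _ → ρ) *_) (numBlocks≡blocks (fromVector (finToFun j)))) ⟩
      (sum {k ℕ.^ M} λ j → product {M} (λ _ → ρ) * blocks (fromVector (finToFun j)))
        ≡⟨ sum-finToFun M blocks-extensional ⟩
      E M (λ f → blocks (fromVector f))
        ≡⟨ E-blocks ⟩
      expected ∎

-- Integer powers and the closed form

^-inverse : ∀ p .{{_ : ℚ.NonZero p}} m → (1/ p) ^ m * p ^ m ≡ 1ℚ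
^-inverse p zero    = refl
^-inverse p (suc m) = begin
  (1/ p * (1/ p) ^ m) * (p * p ^ m)
    ≡⟨ solve 4 (λ a b c d → (a :* b) :* (c :* d) := (a :* c) :* (b :* d)) refl (1/ p) ((1/ p) ^ m) p (p ^ m) ⟩
  (1/ p * p) * ((1/ p) ^ m * p ^ m)
    ≡⟨ cong₂ _*_ (ℚ.*-inverseˡ p) (^-inverse p m) ⟩
  1ℚ ∎

-- The difference may be negative: the exponent in the closed form is `1 - ℓ` for a path of one
-- vertex. Factors are cancelled from both powers until one exponent is zero.
^ℤ-⊖ : ∀ p .{{_ : ℚ.NonZero p}} a b → p ^ℤ (a ℤ.⊖ b) * p ^ b ≡ p ^ a
^ℤ-⊖ p a       zero    = ℚ.*-identityʳ (p ^ a)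
^ℤ-⊖ p zero    (suc b) = ^-inverse p (suc b)
^ℤ-⊖ p (suc a) (suc b) = begin
  p ^ℤ (suc a ℤ.⊖ suc b) * (p * p ^ b)  ≡⟨ cong (λ z → p ^ℤ z * (p * p ^ b)) (ℤ.[1+m]⊖[1+n]≡m⊖n a b) ⟩
  p ^ℤ (a ℤ.⊖ b) * (p * p ^ b)          ≡⟨ solve 3 (λ x y z → x :* (y :* z) := y :* (x :* z)) refl (p ^ℤ (a ℤ.⊖ b)) p (p ^ b) ⟩
  p * (p ^ℤ (a ℤ.⊖ b) * p ^ b)          ≡⟨ cong (p *_) (^ℤ-⊖ p a b) ⟩
  p * p ^ a                             ∎

module _ (κ ρ : ℚ) (ρκ≡1 : ρ * κ ≡ 1ℚ) where

  κ^ℓ*[1-ρ]^ℓ : ∀ ℓ → κ ^ ℓ * (1ℚ - ρ) ^ ℓ ≡ (κ - 1ℚ) ^ ℓ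
  κ^ℓ*[1-ρ]^ℓ ℓ = trans (sym (^-distrib-* κ (1ℚ - ρ) ℓ)) (cong (_^ ℓ) (begin
    κ * (1ℚ - ρ)  ≡⟨ solve 2 (λ x y → x :* (con 1ℚ :- y) := x :- y :* x) refl κ ρ ⟩
    κ - ρ * κ     ≡⟨ cong (κ -_) ρκ≡1 ⟩
    κ - 1ℚ        ∎))

  κ^2ℓ*[1-ρ²]^ℓ : ∀ ℓ → κ ^ (2 ℕ.* ℓ) * (1ℚ - ρ * ρ) ^ ℓ ≡ (κ ^ 2 - 1ℚ) ^ ℓ
  κ^2ℓ*[1-ρ²]^ℓ ℓ = begin
    κ ^ (2 ℕ.* ℓ) * (1ℚ - ρ * ρ) ^ ℓ  ≡⟨ cong (_* (1ℚ - ρ * ρ) ^ ℓ) (^-assocʳ κ 2 ℓ) ⟨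
    (κ ^ 2) ^ ℓ * (1ℚ - ρ * ρ) ^ ℓ    ≡⟨ ^-distrib-* (κ ^ 2) (1ℚ - ρ * ρ) ℓ ⟨
    (κ ^ 2 * (1ℚ - ρ * ρ)) ^ ℓ        ≡⟨ cong (_^ ℓ) (solve 2 (λ x y → (x :* (x :* con 1ℚ)) :* (con 1ℚ :- y :* y)
                                            := x :* (x :* con 1ℚ) :- (y :* x) :* (y :* x)) refl κ ρ) ⟩
    (κ ^ 2 - (ρ * κ) * (ρ * κ)) ^ ℓ   ≡⟨ cong (λ z → (κ ^ 2 - z * z) ^ ℓ) ρκ≡1 ⟩
    (κ ^ 2 - 1ℚ) ^ ℓ                  ∎

  [κ²-1]^ℓ : ∀ ℓ → (κ ^ 2 - 1ℚ) ^ ℓ ≡ (κ - 1ℚ) ^ ℓ * (κ + 1ℚ) ^ ℓ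
  [κ²-1]^ℓ ℓ = trans
    (cong (_^ ℓ) (solve 1 (λ x → x :* (x :* con 1ℚ) :- con 1ℚ := (x :- con 1ℚ) :* (x :+ con 1ℚ)) refl κ))
    (^-distrib-* (κ - 1ℚ) (κ + 1ℚ) ℓ)

  κ^2ℓ : ∀ ℓ → κ ^ (2 ℕ.* ℓ) ≡ κ ^ ℓ * κ ^ ℓ
  κ^2ℓ ℓ = trans (^-homo-* κ ℓ (ℓ ℕ.+ 0)) (cong (λ m → κ ^ ℓ * κ ^ m) (ℕ.+-identityʳ ℓ))

  -- `B` stands for `κ ^ (2 ℓ - 1)`, given through `κ * B` so that no truncated exponent enters.
  -- Each term carries one `κ`, so multiplying by `B` supplies the `κ ^ (2 ℓ)` that absorbs all
  -- denominators.
  clear-denominators : ∀ ℓ ν B → κ * B ≡ κ ^ (2 ℕ.* ℓ) →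
    (κ * (1ℚ - (1ℚ - ρ) ^ ℓ) + ν * (κ * ((1ℚ - ρ * ρ) ^ ℓ - (1ℚ - ρ) ^ ℓ))) * B ≡
    (κ ^ (2 ℕ.* ℓ) - (κ ^ 2 - 1ℚ) ^ ℓ) + (κ - 1ℚ) ^ ℓ * ((κ + 1ℚ) ^ ℓ - κ ^ ℓ) * (1ℚ + ν)
  clear-denominators ℓ ν B κB≡κ^2ℓ = begin
    (κ * (1ℚ - y) + ν * (κ * (w - y))) * B
      ≡⟨ solve 5 (λ κ y ν w B → (κ :* (con 1ℚ :- y) :+ ν :* (κ :* (w :- y))) :* B
                   := (κ :* B) :- (κ :* B) :* y :+ ν :* ((κ :* B) :* w :- (κ :* B) :* y)) refl κ y ν w B ⟩
    κ * B - κ * B * y + ν * (κ * B * w - κ * B * y)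
      ≡⟨ cong (λ t → t - t * y + ν * (t * w - t * y)) κB≡κ^2ℓ ⟩
    t - t * y + ν * (t * w - t * y)
      ≡⟨ cong₂ (λ a b → t - a + ν * (b - a)) t*y≡x*d (trans (κ^2ℓ*[1-ρ²]^ℓ ℓ) ([κ²-1]^ℓ ℓ)) ⟩
    t - x * d + ν * (d * z - x * d)
      -- Here `- x * d` is split into `- d * z` and `d * (z - x)`; the latter joins the `ν` equal
      -- terms of the later layers, giving the factor `1 + ν`, the number of all layers.
      ≡⟨ solve 5 (λ t x d ν z → t :- x :* d :+ ν :* (d :* z :- x :* d)
                   := (t :- d :* z) :+ d :* (z :- x) :* (con 1ℚ :+ ν)) refl t x d ν z ⟩
    (t - d * z) + d * (z - x) * (1ℚ + ν)
      ≡⟨ cong (λ q → (t - q) + d * (z - x) * (1ℚ + ν)) ([κ²-1]^ℓ ℓ) ⟨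
    (t - (κ ^ 2 - 1ℚ) ^ ℓ) + d * (z - x) * (1ℚ + ν) ∎
    where
    t = κ ^ (2 ℕ.* ℓ)
    x = κ ^ ℓ
    y = (1ℚ - ρ) ^ ℓ
    w = (1ℚ - ρ * ρ) ^ ℓ
    z = (κ + 1ℚ) ^ ℓ
    d = (κ - 1ℚ) ^ ℓ

    t*y≡x*d : t * y ≡ x * d
    t*y≡x*d = begin
      t * y        ≡⟨ cong (_* y) (κ^2ℓ ℓ) ⟩
      (x * x) * y  ≡⟨ ℚ.*-assoc x x y ⟩
      x * (x * y)  ≡⟨ cong (x *_) (κ^ℓ*[1-ρ]^ℓ ℓ) ⟩
      x * d        ∎

-- As `D` is `A * B`, the fraction on the right is `N` over `B` expanded by `A`.
quotient-unique : ∀ e A B D N .{{_ : ℚ.NonZero D}} → A * B ≡ D → e * B ≡ N → e ≡ (A * N) ÷ D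
quotient-unique e A B D N AB≡D eB≡N = sym (begin
  (A * N) * 1/ D        ≡⟨ cong (λ N → (A * N) * 1/ D) eB≡N ⟨
  (A * (e * B)) * 1/ D  ≡⟨ solve 4 (λ A e B i → (A :* (e :* B)) :* i := e :* ((A :* B) :* i)) refl A e B (1/ D) ⟩
  e * ((A * B) * 1/ D)  ≡⟨ cong (λ D′ → e * (D′ * 1/ D)) AB≡D ⟩
  e * (D * 1/ D)        ≡⟨ cong (e *_) (ℚ.*-inverseʳ D) ⟩
  e * 1ℚ                ≡⟨ ℚ.*-identityʳ e ⟩
  e                     ∎)

theorem6p8 : ∀ (k ℓ n : ℕ) .{{_ : NonZero k}} .{{_ : NonZero ℓ}} .{{_ : NonZero n}} →
  let κ = fromℕ k
      ν = fromℕ n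
      instance
        κ≢0 = fromℕ-nonZero k
        κ^ℓn≢0 = fromℕ^-nonZero k (ℓ ℕ.* n)
  in 𝔼 k (K ℓ □ P n) (X k (K ℓ □ P n)) ≡
     (κ ^ℤ (+ (ℓ ℕ.* n) ℤ.- (+ 2 ℤ.* + ℓ ℤ.- + 1))
       * ((κ ^ (2 ℕ.* ℓ) - (κ ^ 2 - 1ℚ) ^ ℓ)
          + (κ - 1ℚ) ^ ℓ * ((κ + 1ℚ) ^ ℓ - κ ^ ℓ) * ν))
     ÷ (κ ^ (ℓ ℕ.* n))
theorem6p8 k (suc ℓ) (suc n) = trans (𝔼-blocks k (suc ℓ) n) (quotient-unique
  (expected k (suc ℓ) n)
  (κ ^ℤ (+ a ℤ.- (+ 2 ℤ.* + suc ℓ ℤ.- + 1)))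
  (κ ^ b)
  (κ ^ a)
  _
  -- The subtracted integer computes to `+ b`, so the exponent is a difference of two naturals.
  (trans (cong (λ z → κ ^ℤ z * κ ^ b) (ℤ.m-n≡m⊖n a b)) (^ℤ-⊖ κ a b))
  -- The hypothesis `κ * κ ^ b ≡ κ ^ (2 ℕ.* suc ℓ)` holds by `refl`, because `2 ℕ.* suc ℓ` computes
  -- to a successor with predecessor `b`.
  (trans (clear-denominators κ (+ 1 / k) (1/k*k≡1 k) (suc ℓ) (fromℕ n) (κ ^ b) refl)
         (cong (λ ν → (κ ^ (2 ℕ.* suc ℓ) - (κ ^ 2 - 1ℚ) ^ suc ℓ)
                        + (κ - 1ℚ) ^ suc ℓ * ((κ + 1ℚ) ^ suc ℓ - κ ^ suc ℓ) * ν)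
               (sym (fromℕ-suc n)))))
  where
  κ = fromℕ k
  a = suc ℓ ℕ.* suc n
  b = 2 ℕ.* suc ℓ ℕ.∸ 1
  instance
    κ≢0 = fromℕ-nonZero k
    κ^a≢0 = fromℕ^-nonZero k a
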